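{- Let $S,P,Q$ be pairwise disjoint finite sets and consider the equation $\mathcal{K}_{SP}\leftrightarrow\mathcal{K}_{PQ}=\mathcal{K}_{SQ}$, where $\mathcal{K}_{SP},\mathcal{K}_{PQ},\mathcal{K}_{SQ}$ are generalized number lattices on $S\uplus P$, $P\uplus Q$, $S\uplus Q$ respectively. Then 1. given $\mathcal{K}_{SP},\mathcal{K}_{SQ}$, there exists a generalized number lattice $\mathcal{K}_{PQ}$ satisfying the equation iff $\mathcal{K}_{SP}\circ S\supseteq\mathcal{K}_{SQ}\circ S$ and $\mathcal{K}_{SP}\times S\subseteq\mathcal{K}_{SQ}\times S$; 2. given $\mathcal{K}_{SP},\mathcal{K}_{PQ},\mathcal{K}_{SQ}$ satisfying the equation, we have $\mathcal{K}_{SP}\leftrightarrow\mathcal{K}_{SQ}=\mathcal{K}_{PQ}$ iff $\mathcal{K}_{SP}\circ P\supseteq\mathcal{K}_{PQ}\circ P$ and $\mathcal{K}_{SP}\times P\subseteq\mathcal{K}_{PQ}\times P$; 3. given $\mathcal{K}_{SP},\mathcal{K}_{SQ}$, if the equation is satisfied by some generalized number lattice $\hat{\mathcal{K}}_{PQ}$ with $\mathcal{K}_{SP}\circ P\supseteq\hat{\mathcal{K}}_{PQ}\circ P$ and $\mathcal{K}_{SP}\times P\subseteq\hat{\mathcal{K}}_{PQ}\times P$, then it is the unique such solution.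
   Context: All vectors are over $\mathbb{Q}$; a vector on a finite set $X$ is a function $X\to\mathbb{Q}$, $0_X$ the zero vector, $(f_X,g_Y)$ the vector on $X\uplus Y$ formed from $f_X,g_Y$. A number lattice on $X$ is the set of all integer linear combinations of finitely many vectors on $X$; a generalized number lattice on $X$ is a set $L_X+\mathcal{V}_X$ with $L_X$ a number lattice and $\mathcal{V}_X$ a vector subspace. Restriction: $\mathcal{K}_{SP}\circ S=\{f_S:\exists f_P,(f_S,f_P)\in\mathcal{K}_{SP}\}$; contraction: $\mathcal{K}_{SP}\times S=\{f_S:(f_S,0_P)\in\mathcal{K}_{SP}\}$. Matched composition of $\mathcal{K}_{AB},\mathcal{K}_{BC}$ ($A,B,C$ pairwise disjoint, sets of vectors indexed by sets so $\mathcal{K}_{AB}=\mathcal{K}_{BA}$): $\mathcal{K}_{AB}\leftrightarrow\mathcal{K}_{BC}=\{(f_A,g_C):\exists h_B,\ (f_A,h_B)\in\mathcal{K}_{AB},(h_B,g_C)\in\mathcal{K}_{BC}\}$. -}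

module Defs where

open import Data.Nat using (ℕ; zero; suc)
open import Data.Integer using (ℤ; +_)
open import Data.Rational using (ℚ; 0ℚ; _+_; _*_; _/_)
open import Data.Fin using (Fin; zero; suc)
open import Data.Sum using (_⊎_; inj₁; inj₂; [_,_]) renaming (swap to ⊎-swap)
open import Data.Product using (Σ; ∃; _×_; _,_)
open import Relation.Binary.PropositionalEquality using (_≡_)

Vector : Set → Set
Vector X = X → ℚ

VSet : Set → Set₁
VSet X = Vector X → Set

_≈_ : {X : Set} → Vector X → Vector X → Set
f ≈ g = ∀ x → f x ≡ g x

0v : {X : Set} → Vector X
0v _ = 0ℚ

_+v_ : {X : Set} → Vector X → Vector X → Vector X
(f +v g) x = f x + g x

_·v_ : {X : Set} → ℚ → Vector X → Vector X
(a ·v f) x = a * f x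

ℤ→ℚ : ℤ → ℚ
ℤ→ℚ z = z / 1

intComb : {X : Set} (m : ℕ) → (Fin m → ℤ) → (Fin m → Vector X) → Vector X
intComb zero    c g = 0v
intComb (suc m) c g = (ℤ→ℚ (c zero) ·v g zero) +v intComb m (λ i → c (suc i)) (λ i → g (suc i))

record IsSubspace {X : Set} (V : VSet X) : Set where
  field
    resp  : ∀ {f g} → f ≈ g → V f → V g
    zero∈ : V 0v
    +∈    : ∀ {f g} → V f → V g → V (f +v g)
    ·∈    : ∀ a {f} → V f → V (a ·v f)

-- Number lattice + subspace: K = L + V with L the integer span of finitely many vectors.
IsGNL : {X : Set} → VSet X → Set₁
IsGNL {X} K =
  Σ ℕ λ m → Σ (Fin m → Vector X) λ gens → Σ (VSet X) λ V → IsSubspace V ×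
    (∀ f → (K f → Σ (Fin m → ℤ) λ c → Σ (Vector X) λ v → V v × (f ≈ (intComb m c gens +v v)))
         × ((Σ (Fin m → ℤ) λ c → Σ (Vector X) λ v → V v × (f ≈ (intComb m c gens +v v))) → K f))

_⊆_ : {X : Set} → VSet X → VSet X → Set
K ⊆ K' = ∀ f → K f → K' f

_≐_ : {X : Set} → VSet X → VSet X → Set
K ≐ K' = (K ⊆ K') × (K' ⊆ K)

pair : {A B : Set} → Vector A → Vector B → Vector (A ⊎ B)
pair f g = [ f , g ]

-- reindex a set on A ⊎ B as a set on B ⊎ A (K_AB = K_BA)
flip⊎ : {A B : Set} → VSet (A ⊎ B) → VSet (B ⊎ A)
flip⊎ K h = K (λ x → h (⊎-swap x))

restrict : {A B : Set} → VSet (A ⊎ B) → VSet A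
restrict {A} {B} K f = Σ (Vector B) λ g → K (pair f g)

contract : {A B : Set} → VSet (A ⊎ B) → VSet A
contract K f = K (pair f 0v)

compose : {A B C : Set} → VSet (A ⊎ B) → VSet (B ⊎ C) → VSet (A ⊎ C)
compose {A} {B} {C} K L fg =
  Σ (Vector B) λ h → K (pair (λ a → fg (inj₁ a)) h) × L (pair h (λ c → fg (inj₂ c)))

{-# OPTIONS --safe #-}

-- All of the theorem except the existence in part 1 is diagram chasing with
-- sets closed under integer combinations.
--
-- For the existence, let K_SP = L_SP + V_SP and K_SQ = L_SQ + V_SQ.  The
-- subspaces are arbitrary predicates, so K_SP ↔ K_SQ need not be a generalized
-- number lattice constructively.  Instead, each generator (s_i , q_i) of L_SQ
-- gets some p_i with (s_i , p_i) ∈ K_SP, and K_PQ is the integer span of the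
-- (p_i , q_i) plus V_SP ↔ V_SQ.  This works because V_SQ ∘ S ⊆ V_SP ∘ S: a
-- subspace contained in L + V is contained in V.
module Submission where

open import Defs
open import Data.Nat using (ℕ; zero; suc)
import Data.Nat as ℕ
import Data.Nat.Properties as ℕ
import Data.Nat.Divisibility as ℕ
open import Data.Integer using (ℤ; ∣_∣; 0ℤ; 1ℤ; -1ℤ)
import Data.Integer as ℤ
import Data.Integer.Properties as ℤ
open import Data.Rational using (ℚ; 0ℚ; 1ℚ; _+_; _*_; 1/_; ≢-nonZero)
open import Data.Rational.Properties using (toℚᵘ-injective; toℚᵘ-fromℚᵘ; fromℚᵘ-injective; toℚᵘ-homo-+; toℚᵘ-homo-*; *-inverseʳ; *-identityˡ; *-zeroˡ; *-zeroʳ; +-identityˡ; +-identityʳ; +-assoc)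
open import Data.Rational.Solver using (module +-*-Solver)
open import Data.Rational.Unnormalised using (mkℚᵘ; *≡*)
import Data.Rational.Unnormalised.Properties as ℚᵘ
open import Data.Fin using (Fin; zero; suc)
open import Data.Sum using (_⊎_; inj₁; inj₂) renaming (swap to ⊎-swap)
open import Data.Product using (Σ; ∃; _×_; _,_; proj₁; proj₂)
open import Function using (_∘_; id; case_of_)
open import Relation.Nullary using (yes; no; contradiction)
open import Relation.Binary.PropositionalEquality using (_≡_; _≢_; refl; sym; trans; cong; cong₂; module ≡-Reasoning)

open +-*-Solver using (solve; _:+_; _:*_; _:=_)
open ≡-Reasoning

-- The embedding of ℤ in ℚ

-- `z / 1` is normalised by a gcd, which is stuck on variables. Among unnormalised rationals all
-- denominators are 1 and only an integer identity remains.
ℤ→ℚ-homo-+ : ∀ a b → ℤ→ℚ (a ℤ.+ b) ≡ ℤ→ℚ a + ℤ→ℚ b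
ℤ→ℚ-homo-+ a b = toℚᵘ-injective (ℚᵘ.≃-trans (toℚᵘ-fromℚᵘ (mkℚᵘ (a ℤ.+ b) 0)) (ℚᵘ.≃-sym
  (ℚᵘ.≃-trans (toℚᵘ-homo-+ (ℤ→ℚ a) (ℤ→ℚ b))
  (ℚᵘ.≃-trans (ℚᵘ.+-cong (toℚᵘ-fromℚᵘ (mkℚᵘ a 0)) (toℚᵘ-fromℚᵘ (mkℚᵘ b 0)))
  (*≡* (cong (ℤ._* 1ℤ) (cong₂ ℤ._+_ (ℤ.*-identityʳ a) (ℤ.*-identityʳ b))))))))

ℤ→ℚ-homo-* : ∀ a b → ℤ→ℚ (a ℤ.* b) ≡ ℤ→ℚ a * ℤ→ℚ b
ℤ→ℚ-homo-* a b = toℚᵘ-injective (ℚᵘ.≃-trans (toℚᵘ-fromℚᵘ (mkℚᵘ (a ℤ.* b) 0)) (ℚᵘ.≃-sym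
  (ℚᵘ.≃-trans (toℚᵘ-homo-* (ℤ→ℚ a) (ℤ→ℚ b))
  (ℚᵘ.*-cong (toℚᵘ-fromℚᵘ (mkℚᵘ a 0)) (toℚᵘ-fromℚᵘ (mkℚᵘ b 0))))))

ℤ→ℚ-≡0 : ∀ {a} → ℤ→ℚ a ≡ 0ℚ → a ≡ 0ℤ
ℤ→ℚ-≡0 {a} eq with fromℚᵘ-injective {mkℚᵘ a 0} {mkℚᵘ 0ℤ 0} eq
... | *≡* e = trans (sym (ℤ.*-identityʳ a)) e

ℤ→ℚ-invertible : ∀ {a} → a ≢ 0ℤ → ∃ λ r → ℤ→ℚ a * r ≡ 1ℚ
ℤ→ℚ-invertible {a} a≢0 = 1/ ℤ→ℚ a , *-inverseʳ (ℤ→ℚ a)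
  where instance _ = ≢-nonZero (a≢0 ∘ ℤ→ℚ-≡0)

y+-1*y≡0 : ∀ y → y + ℤ→ℚ -1ℤ * y ≡ 0ℚ
y+-1*y≡0 y = trans (cong (_+ ℤ→ℚ -1ℤ * y) (sym (*-identityˡ y)))
  -- `1ℚ + ℤ→ℚ -1ℤ` evaluates to `0ℚ`, so `*-zeroˡ` applies to the factored form.
  (trans (solve 3 (λ o m y → o :* y :+ m :* y := (o :+ m) :* y) refl 1ℚ (ℤ→ℚ -1ℤ) y) (*-zeroˡ y))

-- A number larger than `∣ c ∣` divides `c` only when `c` is zero.
multiple-of-1+∣i∣⇒≡0 : ∀ c c′ → c ≡ ℤ.+ suc ∣ c ∣ ℤ.* c′ → c ≡ 0ℤ
multiple-of-1+∣i∣⇒≡0 c c′ eq with ∣ c ∣ ℕ.≟ 0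
... | yes ∣c∣≡0 = ℤ.∣i∣≡0⇒i≡0 ∣c∣≡0
... | no  ∣c∣≢0 = contradiction
  (ℕ.divides ∣ c′ ∣ (trans (cong ∣_∣ eq) (trans (ℤ.abs-* (ℤ.+ suc ∣ c ∣) c′) (ℕ.*-comm (suc ∣ c ∣) ∣ c′ ∣))))
  (ℕ.>⇒∤ (ℕ.n<1+n ∣ c ∣))
  where instance _ = ℕ.≢-nonZero ∣c∣≢0

-- Sets closed under integer combinations

-- The structure shared by subspaces and generalized number lattices. Subtraction is addition of the
-- multiple by `-1ℤ`.
record IsℤModule {X : Set} (K : VSet X) : Set where
  field
    resp  : ∀ {f g} → f ≈ g → K f → K g
    zero∈ : K 0v
    +∈    : ∀ {f g} → K f → K g → K (f +v g)
    ·∈    : ∀ z {f} → K f → K (ℤ→ℚ z ·v f)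

private variable
  X A B C : Set

subspace⇒ℤModule : {V : VSet X} → IsSubspace V → IsℤModule V
subspace⇒ℤModule V = record
  { resp = V.resp ; zero∈ = V.zero∈ ; +∈ = V.+∈ ; ·∈ = λ z → V.·∈ (ℤ→ℚ z) }
  where module V = IsSubspace V

intComb-∈ : {K : VSet X} → IsℤModule K → ∀ m c {g : Fin m → Vector X} → (∀ i → K (g i)) → K (intComb m c g)
intComb-∈ K zero    c g∈ = IsℤModule.zero∈ K
intComb-∈ K (suc m) c g∈ =
  IsℤModule.+∈ K (IsℤModule.·∈ K (c zero) (g∈ zero)) (intComb-∈ K m (c ∘ suc) (g∈ ∘ suc))

-- Combinations are formed pointwise. With `φ` equal to `inj₁` or `inj₂` this computes the two
-- components of a combination.
intComb-∘ : (φ : A → B) → ∀ m c (g : Fin m → Vector B) →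
  (intComb m c g ∘ φ) ≈ intComb m c (λ i → g i ∘ φ)
intComb-∘ φ zero    c g x = refl
intComb-∘ φ (suc m) c g x = cong ((ℤ→ℚ (c zero) * g zero (φ x)) +_) (intComb-∘ φ m (c ∘ suc) (g ∘ suc) x)

intComb-0 : ∀ m (g : Fin m → Vector X) → intComb m (λ _ → 0ℤ) g ≈ 0v
intComb-0 zero    g x = refl
intComb-0 (suc m) g x = begin
  0ℚ * g zero x + intComb m (λ _ → 0ℤ) (g ∘ suc) x ≡⟨ cong₂ _+_ (*-zeroˡ (g zero x)) (intComb-0 m (g ∘ suc) x) ⟩
  0ℚ + 0ℚ                                          ≡⟨⟩
  0ℚ                                               ∎

intComb-+ : ∀ m c c′ (g : Fin m → Vector X) →
  intComb m (λ i → c i ℤ.+ c′ i) g ≈ (intComb m c g +v intComb m c′ g)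
intComb-+ zero    c c′ g x = refl
intComb-+ (suc m) c c′ g x = begin
  ℤ→ℚ (c zero ℤ.+ c′ zero) * g zero x + intComb m _ (g ∘ suc) x
    ≡⟨ cong₂ (λ a b → a * g zero x + b) (ℤ→ℚ-homo-+ (c zero) (c′ zero)) (intComb-+ m (c ∘ suc) (c′ ∘ suc) (g ∘ suc) x) ⟩
  (ℤ→ℚ (c zero) + ℤ→ℚ (c′ zero)) * g zero x + (u + u′)
    ≡⟨ solve 5 (λ a b y u u′ → (a :+ b) :* y :+ (u :+ u′) := (a :* y :+ u) :+ (b :* y :+ u′)) refl
         (ℤ→ℚ (c zero)) (ℤ→ℚ (c′ zero)) (g zero x) u u′ ⟩
  (ℤ→ℚ (c zero) * g zero x + u) + (ℤ→ℚ (c′ zero) * g zero x + u′) ∎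
  where
  u  = intComb m (c ∘ suc) (g ∘ suc) x
  u′ = intComb m (c′ ∘ suc) (g ∘ suc) x

intComb-· : ∀ m z c (g : Fin m → Vector X) →
  intComb m (λ i → z ℤ.* c i) g ≈ (ℤ→ℚ z ·v intComb m c g)
intComb-· zero    z c g x = sym (*-zeroʳ (ℤ→ℚ z))
intComb-· (suc m) z c g x = begin
  ℤ→ℚ (z ℤ.* c zero) * g zero x + intComb m _ (g ∘ suc) x
    ≡⟨ cong₂ (λ a b → a * g zero x + b) (ℤ→ℚ-homo-* z (c zero)) (intComb-· m z (c ∘ suc) (g ∘ suc) x) ⟩
  (ℤ→ℚ z * ℤ→ℚ (c zero)) * g zero x + ℤ→ℚ z * u
    ≡⟨ solve 4 (λ a b y u → (a :* b) :* y :+ a :* u := a :* (b :* y :+ u)) refl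
         (ℤ→ℚ z) (ℤ→ℚ (c zero)) (g zero x) u ⟩
  ℤ→ℚ z * (ℤ→ℚ (c zero) * g zero x + u) ∎
  where u = intComb m (c ∘ suc) (g ∘ suc) x

intComb-generator : ∀ m (g : Fin m → Vector X) i → ∃ λ c → intComb m c g ≈ g i
intComb-generator (suc m) g zero = (λ { zero → 1ℤ ; (suc _) → 0ℤ }) , λ x →
  trans (cong₂ _+_ (*-identityˡ (g zero x)) (intComb-0 m (g ∘ suc) x)) (+-identityʳ (g zero x))
intComb-generator (suc m) g (suc i) with intComb-generator m (g ∘ suc) i
... | c , eq = (λ { zero → 0ℤ ; (suc j) → c j }) , λ x →
  trans (cong₂ _+_ (*-zeroˡ (g zero x)) (eq x)) (+-identityˡ (g (suc i) x))

-- Generalized number lattices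

-- The condition inside `IsGNL` under its own name, so that `id` in both directions makes it a
-- generalized number lattice.
Lattice+ : (m : ℕ) → (Fin m → Vector X) → VSet X → VSet X
Lattice+ {X} m g V f = Σ (Fin m → ℤ) λ c → Σ (Vector X) λ v → V v × (f ≈ (intComb m c g +v v))

Lattice+-isGNL : ∀ m (g : Fin m → Vector X) {V : VSet X} → IsSubspace V → IsGNL (Lattice+ m g V)
Lattice+-isGNL m g V = m , g , _ , V , λ f → id , id

Lattice+-isℤModule : ∀ m (g : Fin m → Vector X) {V : VSet X} → IsSubspace V → IsℤModule (Lattice+ m g V)
Lattice+-isℤModule m g V = record
  { resp  = λ f≈f′ → λ { (c , v , v∈ , eq) → c , v , v∈ , λ x → trans (sym (f≈f′ x)) (eq x) }
  ; zero∈ = (λ _ → 0ℤ) , 0v , V.zero∈ , λ x → sym (cong (_+ 0ℚ) (intComb-0 m g x))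
  ; +∈    = λ { {f} {f′} (c , v , v∈ , eq) (c′ , v′ , v′∈ , eq′) →
      (λ i → c i ℤ.+ c′ i) , (v +v v′) , V.+∈ v∈ v′∈ , λ x → begin
        f x + f′ x
          ≡⟨ cong₂ _+_ (eq x) (eq′ x) ⟩
        (intComb m c g x + v x) + (intComb m c′ g x + v′ x)
          ≡⟨ solve 4 (λ a b a′ b′ → (a :+ b) :+ (a′ :+ b′) := (a :+ a′) :+ (b :+ b′)) refl
               (intComb m c g x) (v x) (intComb m c′ g x) (v′ x) ⟩
        (intComb m c g x + intComb m c′ g x) + (v x + v′ x)
          ≡⟨ cong (_+ (v x + v′ x)) (sym (intComb-+ m c c′ g x)) ⟩
        intComb m (λ i → c i ℤ.+ c′ i) g x + (v x + v′ x) ∎ }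
  ; ·∈    = λ { z {f} (c , v , v∈ , eq) →
      (λ i → z ℤ.* c i) , (ℤ→ℚ z ·v v) , V.·∈ (ℤ→ℚ z) v∈ , λ x → begin
        ℤ→ℚ z * f x
          ≡⟨ cong (ℤ→ℚ z *_) (eq x) ⟩
        ℤ→ℚ z * (intComb m c g x + v x)
          ≡⟨ solve 3 (λ z a b → z :* (a :+ b) := z :* a :+ z :* b) refl (ℤ→ℚ z) (intComb m c g x) (v x) ⟩
        ℤ→ℚ z * intComb m c g x + ℤ→ℚ z * v x
          ≡⟨ cong (_+ ℤ→ℚ z * v x) (sym (intComb-· m z c g x)) ⟩
        intComb m (λ i → z ℤ.* c i) g x + ℤ→ℚ z * v x ∎ }
  }
  where module V = IsSubspace V

subspace⊆Lattice+ : ∀ m (g : Fin m → Vector X) {V : VSet X} → V ⊆ Lattice+ m g V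
subspace⊆Lattice+ m g f f∈ = (λ _ → 0ℤ) , f , f∈ , λ x →
  sym (trans (cong (_+ f x) (intComb-0 m g x)) (+-identityˡ (f x)))

generator∈Lattice+ : ∀ m (g : Fin m → Vector X) {V : VSet X} → IsSubspace V → ∀ i → Lattice+ m g V (g i)
generator∈Lattice+ m g V i with intComb-generator m g i
... | c , eq = c , 0v , IsSubspace.zero∈ V , λ x → sym (trans (+-identityʳ _) (eq x))

GNL⇒ℤModule : {K : VSet X} → IsGNL K → IsℤModule K
GNL⇒ℤModule (m , g , V , V-subspace , K⇔) = record
  { resp  = λ {f} {h} f≈h f∈ → proj₂ (K⇔ h) (L.resp f≈h (proj₁ (K⇔ f) f∈))
  ; zero∈ = proj₂ (K⇔ _) L.zero∈
  ; +∈    = λ f∈ h∈ → proj₂ (K⇔ _) (L.+∈ (proj₁ (K⇔ _) f∈) (proj₁ (K⇔ _) h∈))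
  ; ·∈    = λ z f∈ → proj₂ (K⇔ _) (L.·∈ z (proj₁ (K⇔ _) f∈))
  }
  where module L = IsℤModule (Lattice+-isℤModule m g V-subspace)

-- Divisible elements

-- The quotient of `ℤ l + K` by `K` is cyclic, and by `line⊆` the line through `d` has a divisible
-- image in it. A cyclic group has no nonzero divisible subgroup, so the line lies in `K`.
module _ {K : VSet X} (K-ℤModule : IsℤModule K) (l d : Vector X)
         (line⊆ : ∀ a → Σ ℤ λ c → Σ (Vector X) λ k → K k × ((a ·v d) ≈ ((ℤ→ℚ c ·v l) +v k)))
  where
  open IsℤModule K-ℤModule

  private
    -- Every point of the line is `n` times another point of the line, to which `line⊆` can be
    -- applied in turn.
    unscale : ∀ n r → ℤ→ℚ n * r ≡ 1ℚ → ∀ a x → a * d x ≡ ℤ→ℚ n * ((r * a) * d x)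
    unscale n r nr≡1 a x = begin
      a * d x                       ≡⟨ sym (*-identityˡ _) ⟩
      1ℚ * (a * d x)                ≡⟨ cong (_* (a * d x)) (sym nr≡1) ⟩
      (ℤ→ℚ n * r) * (a * d x)       ≡⟨ solve 4 (λ n r a y → (n :* r) :* (a :* y) := n :* ((r :* a) :* y)) refl (ℤ→ℚ n) r a (d x) ⟩
      ℤ→ℚ n * ((r * a) * d x)       ∎

  -- Here `l` has finite order modulo `K`. Writing a point as `b` times `c l + k` turns its `l`-part
  -- into `c (b l)`, which lies in `K`.
  multiple-∈⇒line-∈ : ∀ {b} → b ≢ 0ℤ → K (ℤ→ℚ b ·v l) → ∀ a → K (a ·v d)
  multiple-∈⇒line-∈ {b} b≢0 bl∈ a with ℤ→ℚ-invertible b≢0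
  ... | r , br≡1 with line⊆ (r * a)
  ... | c , k , k∈ , eq = resp (λ x → sym (begin
    a * d x                                        ≡⟨ unscale b r br≡1 a x ⟩
    ℤ→ℚ b * ((r * a) * d x)                        ≡⟨ cong (ℤ→ℚ b *_) (eq x) ⟩
    ℤ→ℚ b * (ℤ→ℚ c * l x + k x)                    ≡⟨ solve 4 (λ b c l k → b :* (c :* l :+ k) := c :* (b :* l) :+ b :* k) refl (ℤ→ℚ b) (ℤ→ℚ c) (l x) (k x) ⟩
    ℤ→ℚ c * (ℤ→ℚ b * l x) + ℤ→ℚ b * k x            ∎))
    (+∈ (·∈ c bl∈) (·∈ b k∈))

  -- Comparing a d = c l + k with N times a decomposition of (a / N) d, where
  -- N = 1 + |c|, shows that a nonzero multiple of l lies in K.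
  nonzero-coefficient⇒multiple-∈ : ∀ a c k → K k → (a ·v d) ≈ ((ℤ→ℚ c ·v l) +v k) → c ≢ 0ℤ →
    Σ ℤ λ b → b ≢ 0ℤ × K (ℤ→ℚ b ·v l)
  nonzero-coefficient⇒multiple-∈ a c k k∈ eq c≢0 =
    b , b≢0 , resp (λ x → sym (bl≡ x)) (+∈ (·∈ N k′∈) (·∈ -1ℤ k∈))
    where
    N : ℤ
    N = ℤ.+ suc ∣ c ∣

    inverse : ∃ λ r → ℤ→ℚ N * r ≡ 1ℚ
    inverse = ℤ→ℚ-invertible {N} λ ()

    r    = proj₁ inverse
    Nr≡1 = proj₂ inverse

    c′  = proj₁ (line⊆ (r * a))
    k′  = proj₁ (proj₂ (line⊆ (r * a)))
    k′∈ = proj₁ (proj₂ (proj₂ (line⊆ (r * a))))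
    eq′ = proj₂ (proj₂ (proj₂ (line⊆ (r * a))))

    -- The coefficient of `l` in the difference of the two forms. It vanishes only if `N` divides
    -- `c`, which `N > ∣ c ∣` excludes for nonzero `c`.
    b : ℤ
    b = c ℤ.+ -1ℤ ℤ.* (N ℤ.* c′)

    b≢0 : b ≢ 0ℤ
    b≢0 b≡0 = c≢0 (multiple-of-1+∣i∣⇒≡0 c c′ (ℤ.i-j≡0⇒i≡j c (N ℤ.* c′)
      (trans (cong (λ i → c ℤ.+ i) (sym (ℤ.-1*i≡-i (N ℤ.* c′)))) b≡0)))

    two-forms : ∀ x → ℤ→ℚ c * l x + k x ≡ ℤ→ℚ N * (ℤ→ℚ c′ * l x + k′ x)
    two-forms x = begin
      ℤ→ℚ c * l x + k x                  ≡⟨ sym (eq x) ⟩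
      a * d x                            ≡⟨ unscale N r Nr≡1 a x ⟩
      ℤ→ℚ N * ((r * a) * d x)            ≡⟨ cong (ℤ→ℚ N *_) (eq′ x) ⟩
      ℤ→ℚ N * (ℤ→ℚ c′ * l x + k′ x)      ∎

    bl≡ : ∀ x → ℤ→ℚ b * l x ≡ ℤ→ℚ N * k′ x + ℤ→ℚ -1ℤ * k x
    bl≡ x = begin
      ℤ→ℚ b * l x
        ≡⟨ cong (_* l x) (trans (ℤ→ℚ-homo-+ c _) (cong (ℤ→ℚ c +_) (trans (ℤ→ℚ-homo-* -1ℤ (N ℤ.* c′)) (cong (ℤ→ℚ -1ℤ *_) (ℤ→ℚ-homo-* N c′))))) ⟩
      (ℤ→ℚ c + ℤ→ℚ -1ℤ * (ℤ→ℚ N * ℤ→ℚ c′)) * l x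
        ≡⟨ sym (+-identityʳ _) ⟩
      (ℤ→ℚ c + ℤ→ℚ -1ℤ * (ℤ→ℚ N * ℤ→ℚ c′)) * l x + 0ℚ
        ≡⟨ cong (((ℤ→ℚ c + ℤ→ℚ -1ℤ * (ℤ→ℚ N * ℤ→ℚ c′)) * l x) +_) (sym (y+-1*y≡0 (k x))) ⟩
      (ℤ→ℚ c + ℤ→ℚ -1ℤ * (ℤ→ℚ N * ℤ→ℚ c′)) * l x + (k x + ℤ→ℚ -1ℤ * k x)
        ≡⟨ solve 6 (λ c m n c′ l k → (c :+ m :* (n :* c′)) :* l :+ (k :+ m :* k)
                                  := (c :* l :+ k) :+ m :* (n :* (c′ :* l) :+ k)) refl
             (ℤ→ℚ c) (ℤ→ℚ -1ℤ) (ℤ→ℚ N) (ℤ→ℚ c′) (l x) (k x) ⟩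
      (ℤ→ℚ c * l x + k x) + ℤ→ℚ -1ℤ * (ℤ→ℚ N * (ℤ→ℚ c′ * l x) + k x)
        ≡⟨ cong (_+ ℤ→ℚ -1ℤ * (ℤ→ℚ N * (ℤ→ℚ c′ * l x) + k x)) (two-forms x) ⟩
      ℤ→ℚ N * (ℤ→ℚ c′ * l x + k′ x) + ℤ→ℚ -1ℤ * (ℤ→ℚ N * (ℤ→ℚ c′ * l x) + k x)
        ≡⟨ solve 5 (λ m n y k k′ → n :* (y :+ k′) :+ m :* (n :* y :+ k)
                                := (n :* y :+ m :* (n :* y)) :+ (n :* k′ :+ m :* k)) refl
             (ℤ→ℚ -1ℤ) (ℤ→ℚ N) (ℤ→ℚ c′ * l x) (k x) (k′ x) ⟩
      (ℤ→ℚ N * (ℤ→ℚ c′ * l x) + ℤ→ℚ -1ℤ * (ℤ→ℚ N * (ℤ→ℚ c′ * l x))) + (ℤ→ℚ N * k′ x + ℤ→ℚ -1ℤ * k x)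
        ≡⟨ cong (_+ (ℤ→ℚ N * k′ x + ℤ→ℚ -1ℤ * k x)) (y+-1*y≡0 (ℤ→ℚ N * (ℤ→ℚ c′ * l x))) ⟩
      0ℚ + (ℤ→ℚ N * k′ x + ℤ→ℚ -1ℤ * k x)
        ≡⟨ +-identityˡ _ ⟩
      ℤ→ℚ N * k′ x + ℤ→ℚ -1ℤ * k x ∎

  divisible-drop : ∀ a → K (a ·v d)
  divisible-drop a =
    -- Membership in `K` is not assumed decidable, so the case split is on the integer coefficient.
    let c , k , k∈ , eq = line⊆ a in case c ℤ.≟ 0ℤ of λ where
      (yes c≡0) → resp (λ x → sym (begin
        a * d x            ≡⟨ eq x ⟩
        ℤ→ℚ c * l x + k x  ≡⟨ cong (λ i → ℤ→ℚ i * l x + k x) c≡0 ⟩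
        0ℚ * l x + k x     ≡⟨ cong (_+ k x) (*-zeroˡ (l x)) ⟩
        0ℚ + k x           ≡⟨ +-identityˡ (k x) ⟩
        k x                ∎)) k∈
      (no c≢0) →
        let b , b≢0 , bl∈ = nonzero-coefficient⇒multiple-∈ a c k k∈ eq c≢0
        in multiple-∈⇒line-∈ b≢0 bl∈ a

-- Induction on the number of generators: the first is dropped by divisibility, relative to the
-- lattice of the others plus `V`. Without generators, the point `1 d` gives the claim.
line⊆Lattice+⇒∈ : ∀ m (g : Fin m → Vector X) {V : VSet X} → IsSubspace V →
  ∀ d → (∀ a → Lattice+ m g V (a ·v d)) → V d
line⊆Lattice+⇒∈ zero g V d line⊆ with line⊆ 1ℚ
... | _ , v , v∈ , eq = IsSubspace.resp V
  (λ x → trans (sym (+-identityˡ (v x))) (trans (sym (eq x)) (*-identityˡ (d x)))) v∈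
line⊆Lattice+⇒∈ (suc m) g {V} V-subspace d line⊆ = line⊆Lattice+⇒∈ m (g ∘ suc) V-subspace d
  (divisible-drop (Lattice+-isℤModule m (g ∘ suc) V-subspace) (g zero) d λ a → split (line⊆ a))
  where
  split : ∀ {f} → Lattice+ (suc m) g V f →
    Σ ℤ λ c → Σ (Vector _) λ k → Lattice+ m (g ∘ suc) V k × (f ≈ ((ℤ→ℚ c ·v g zero) +v k))
  split (c , v , v∈ , eq) = c zero , (intComb m (c ∘ suc) (g ∘ suc) +v v) ,
    (c ∘ suc , v , v∈ , λ x → refl) ,
    λ x → trans (eq x) (+-assoc (ℤ→ℚ (c zero) * g zero x) (intComb m (c ∘ suc) (g ∘ suc) x) (v x))

-- Pairs, restriction and composition

pair-cong : {f f′ : Vector A} {g g′ : Vector B} → f ≈ f′ → g ≈ g′ → pair f g ≈ pair f′ g′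
pair-cong f≈ g≈ (inj₁ a) = f≈ a
pair-cong f≈ g≈ (inj₂ b) = g≈ b

-- Only pointwise, as function extensionality is not assumed; memberships are moved across it by
-- `resp`.
pair-η : (h : Vector (A ⊎ B)) → h ≈ pair (h ∘ inj₁) (h ∘ inj₂)
pair-η h (inj₁ a) = refl
pair-η h (inj₂ b) = refl

pair-+ : (f f′ : Vector A) (g g′ : Vector B) → (pair f g +v pair f′ g′) ≈ pair (f +v f′) (g +v g′)
pair-+ f f′ g g′ (inj₁ a) = refl
pair-+ f f′ g g′ (inj₂ b) = refl

pair-· : ∀ r (f : Vector A) (g : Vector B) → (r ·v pair f g) ≈ pair (r ·v f) (r ·v g)
pair-· r f g (inj₁ a) = refl
pair-· r f g (inj₂ b) = refl

pair-swap : (f : Vector A) (g : Vector B) → (λ x → pair f g (⊎-swap x)) ≈ pair g f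
pair-swap f g (inj₁ b) = refl
pair-swap f g (inj₂ a) = refl

≈-sym : {f g : Vector X} → f ≈ g → g ≈ f
≈-sym eq x = sym (eq x)

flip⊎-isℤModule : {K : VSet (A ⊎ B)} → IsℤModule K → IsℤModule (flip⊎ K)
flip⊎-isℤModule K = record
  { resp = λ f≈g → resp (λ x → f≈g (⊎-swap x)) ; zero∈ = zero∈ ; +∈ = λ f∈ g∈ → +∈ f∈ g∈ ; ·∈ = λ a f∈ → ·∈ a f∈ }
  where open IsℤModule K

module _ {K : VSet (A ⊎ B)} (K-ℤModule : IsℤModule K) where
  open IsℤModule K-ℤModule

  flip⊎-pair⁺ : ∀ {f g} → K (pair f g) → flip⊎ K (pair g f)
  flip⊎-pair⁺ = resp (≈-sym (pair-swap _ _))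

  flip⊎-pair⁻ : ∀ {f g} → flip⊎ K (pair g f) → K (pair f g)
  flip⊎-pair⁻ = resp (pair-swap _ _)

  -- Using the same coefficients on both components keeps them matched; `v` and `w` are the two
  -- components of the subspace part.
  intComb-pair-∈ : ∀ m c {f : Fin m → Vector A} {g : Fin m → Vector B} {v w} →
    (∀ i → K (pair (f i) (g i))) → K (pair v w) →
    K (pair (intComb m c f +v v) (intComb m c g +v w))
  intComb-pair-∈ m c {f} {g} {v} {w} fg∈ vw∈ =
    resp eq (+∈ (intComb-∈ K-ℤModule m c fg∈) vw∈)
    where
    eq : (intComb m c (λ i → pair (f i) (g i)) +v pair v w) ≈ pair (intComb m c f +v v) (intComb m c g +v w)
    eq (inj₁ a) = cong (_+ v a) (intComb-∘ inj₁ m c (λ i → pair (f i) (g i)) a)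
    eq (inj₂ b) = cong (_+ w b) (intComb-∘ inj₂ m c (λ i → pair (f i) (g i)) b)

restrict-isSubspace : {V : VSet (A ⊎ B)} → IsSubspace V → IsSubspace (restrict V)
restrict-isSubspace V = record
  { resp  = λ f≈f′ → λ { (g , fg∈) → g , resp (pair-cong f≈f′ λ _ → refl) fg∈ }
  ; zero∈ = 0v , resp (pair-η 0v) zero∈
  ; +∈    = λ { (g , fg∈) (g′ , fg′∈) → (g +v g′) , resp (pair-+ _ _ g g′) (+∈ fg∈ fg′∈) }
  ; ·∈    = λ { a (g , fg∈) → (a ·v g) , resp (pair-· a _ g) (·∈ a fg∈) }
  }
  where open IsSubspace V

compose-isSubspace : {V : VSet (A ⊎ B)} {W : VSet (B ⊎ C)} →
  IsSubspace V → IsSubspace W → IsSubspace (compose V W)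
compose-isSubspace V W = record
  { resp  = λ f≈f′ → λ { (h , v , w) → h , V.resp (pair-cong (λ a → f≈f′ (inj₁ a)) λ _ → refl) v
                                         , W.resp (pair-cong (λ _ → refl) λ c → f≈f′ (inj₂ c)) w }
  ; zero∈ = 0v , V.resp (pair-η 0v) V.zero∈ , W.resp (pair-η 0v) W.zero∈
  ; +∈    = λ { (h , v , w) (h′ , v′ , w′) → (h +v h′) , V.resp (pair-+ _ _ h h′) (V.+∈ v v′)
                                                       , W.resp (pair-+ h h′ _ _) (W.+∈ w w′) }
  ; ·∈    = λ { a (h , v , w) → (a ·v h) , V.resp (pair-· a _ h) (V.·∈ a v)
                                         , W.resp (pair-· a h _) (W.·∈ a w) }
  }
  where
  module V = IsSubspace V
  module W = IsSubspace W

flip⊎-isSubspace : {V : VSet (A ⊎ B)} → IsSubspace V → IsSubspace (flip⊎ V)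
flip⊎-isSubspace V = record
  { resp = λ f≈g → resp (λ x → f≈g (⊎-swap x)) ; zero∈ = zero∈ ; +∈ = λ f∈ g∈ → +∈ f∈ g∈ ; ·∈ = λ a f∈ → ·∈ a f∈ }
  where open IsSubspace V

restrict-Lattice+ : ∀ m (g : Fin m → Vector (A ⊎ B)) {V : VSet (A ⊎ B)} → IsSubspace V →
  restrict (Lattice+ m g V) ⊆ Lattice+ m (λ i → g i ∘ inj₁) (restrict V)
restrict-Lattice+ m g V f (_ , c , v , v∈ , eq) =
  c , v ∘ inj₁ , (v ∘ inj₂ , IsSubspace.resp V (pair-η v) v∈) ,
  λ a → trans (eq (inj₁ a)) (cong (_+ v (inj₁ a)) (intComb-∘ inj₁ m c g a))

-- A subspace contains the whole line through each of its vectors.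
subspace⊆Lattice+⇒⊆ : ∀ m (g : Fin m → Vector X) {V W : VSet X} → IsSubspace V → IsSubspace W →
  W ⊆ Lattice+ m g V → W ⊆ V
subspace⊆Lattice+⇒⊆ m g V W W⊆ d d∈ =
  line⊆Lattice+⇒∈ m g V d λ a → W⊆ (a ·v d) (IsSubspace.·∈ W a d∈)

-- Solutions of K ↔ L = M

-- Subtraction in `K` cancels `h` and leaves `(f - f′ , 0)`, which the contraction hypothesis moves
-- to `M`; adding `(f′ , g)` gives the claim.
exchange : {K : VSet (A ⊎ B)} {M : VSet (A ⊎ C)} → IsℤModule K → IsℤModule M →
  contract K ⊆ contract M → ∀ {f f′ h g} →
  K (pair f h) → K (pair f′ h) → M (pair f′ g) → M (pair f g)
exchange K M K⊆M {f} {f′} {h} {g} fh∈ f′h∈ f′g∈ =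
  M.resp eqM (M.+∈ f′g∈ (K⊆M _ (K.resp eqK (K.+∈ fh∈ (K.·∈ -1ℤ f′h∈)))))
  where
  module K = IsℤModule K
  module M = IsℤModule M

  eqK : (pair f h +v (ℤ→ℚ -1ℤ ·v pair f′ h)) ≈ pair (f +v (ℤ→ℚ -1ℤ ·v f′)) 0v
  eqK (inj₁ a) = refl
  eqK (inj₂ b) = y+-1*y≡0 (h b)

  eqM : (pair f′ g +v pair (f +v (ℤ→ℚ -1ℤ ·v f′)) 0v) ≈ pair f g
  eqM (inj₁ a) = begin
    f′ a + (f a + ℤ→ℚ -1ℤ * f′ a)   ≡⟨ solve 3 (λ x y m → y :+ (x :+ m :* y) := x :+ (y :+ m :* y)) refl (f a) (f′ a) (ℤ→ℚ -1ℤ) ⟩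
    f a + (f′ a + ℤ→ℚ -1ℤ * f′ a)   ≡⟨ cong (f a +_) (y+-1*y≡0 (f′ a)) ⟩
    f a + 0ℚ                        ≡⟨ +-identityʳ (f a) ⟩
    f a                             ∎
  eqM (inj₂ c) = +-identityʳ (g c)

-- The middle vector of an element of the composition witnesses the restriction condition. For the
-- contraction, `(f , 0)` is matched with the zero vector of `L`.
compose-necessary : (K : VSet (A ⊎ B)) {L : VSet (B ⊎ C)} {M : VSet (A ⊎ C)} → IsℤModule L →
  compose K L ≐ M → (restrict M ⊆ restrict K) × (contract K ⊆ contract M)
compose-necessary K L (⊆M , M⊆) =
  (λ { f (g , fg∈) → let h , fh∈ , _ = M⊆ _ fg∈ in h , fh∈ }) ,
  (λ f f0∈ → ⊆M _ (0v , f0∈ , IsℤModule.resp L (pair-η 0v) (IsℤModule.zero∈ L)))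

-- The contraction condition gives one inclusion by `exchange`, the restriction condition supplies
-- the middle vector for the other. The conclusion expresses `L` through `K` and `M`, whence
-- uniqueness.
compose-invert : {K : VSet (A ⊎ B)} {L : VSet (B ⊎ C)} {M : VSet (A ⊎ C)} →
  IsℤModule K → IsℤModule L → compose K L ≐ M →
  restrict L ⊆ restrict (flip⊎ K) → contract (flip⊎ K) ⊆ contract L →
  compose (flip⊎ K) M ≐ L
compose-invert K L (⊆M , M⊆) res con =
  (λ { f (s , ps∈ , sq∈) → let p′ , sp′∈ , p′q∈ = M⊆ _ sq∈ in
    IsℤModule.resp L (≈-sym (pair-η f))
      (exchange (flip⊎-isℤModule K) L con ps∈ (flip⊎-pair⁺ K sp′∈) p′q∈) }) ,
  (λ f f∈ → let pq∈    = IsℤModule.resp L (pair-η f) f∈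
                s , ps∈ = res _ (f ∘ inj₂ , pq∈)
            in s , ps∈ , ⊆M (pair s (f ∘ inj₂)) (f ∘ inj₁ , flip⊎-pair⁻ K ps∈ , pq∈))

compose-sufficient : {K : VSet (A ⊎ B)} {M : VSet (A ⊎ C)} → IsGNL K → IsGNL M →
  restrict M ⊆ restrict K → contract K ⊆ contract M →
  Σ (VSet (B ⊎ C)) λ L → IsGNL L × (compose K L ≐ M)
compose-sufficient {A} {B} {C} {K} {M} K-GNL@(n , l , V , V-subspace , K⇔) M-GNL@(m , g , W , W-subspace , M⇔) res con =
  L , Lattice+-isGNL m gL (compose-isSubspace (flip⊎-isSubspace V-subspace) W-subspace) , L⊆ , ⊆L
  where
  K-ℤModule = GNL⇒ℤModule K-GNL
  M-ℤModule = GNL⇒ℤModule M-GNL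
  V-ℤModule = subspace⇒ℤModule V-subspace
  module M = IsℤModule M-ℤModule

  V⊆K : V ⊆ K
  V⊆K f f∈ = proj₂ (K⇔ f) (subspace⊆Lattice+ n l f f∈)

  W⊆M : W ⊆ M
  W⊆M f f∈ = proj₂ (M⇔ f) (subspace⊆Lattice+ m g f f∈)

  g-pair-∈ : ∀ i → M (pair (g i ∘ inj₁) (g i ∘ inj₂))
  g-pair-∈ i = M.resp (pair-η (g i)) (proj₂ (M⇔ _) (generator∈Lattice+ m g W-subspace i))

  partner : ∀ i → restrict K (g i ∘ inj₁)
  partner i = res _ (g i ∘ inj₂ , g-pair-∈ i)

  gL : Fin m → Vector (B ⊎ C)
  gL i = pair (proj₁ (partner i)) (g i ∘ inj₂)

  L : VSet (B ⊎ C)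
  L = Lattice+ m gL (compose (flip⊎ V) W)

  W⊆V : restrict W ⊆ restrict V
  W⊆V = subspace⊆Lattice+⇒⊆ n (λ i → l i ∘ inj₁) (restrict-isSubspace V-subspace) (restrict-isSubspace W-subspace)
    -- The restriction of `W` lies in that of `M`, hence in that of `K`, which is a lattice plus the
    -- restriction of `V`.
    λ { f (h , fh∈) → let h′ , fh′∈ = res f (h , W⊆M _ fh∈)
                      in restrict-Lattice+ n l V-subspace f (h′ , proj₁ (K⇔ _) fh′∈) }

  L⊆ : compose K L ⊆ M
  L⊆ f (h , fh∈ , c , w , (s , ws∈ , sw∈) , eq) =
    -- The combination of the `A`-parts of the generators, plus `s`, is matched with `h` in `K` and
    -- with the `C`-part of `f` in `M`; `exchange` replaces it by the `A`-part of `f`.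
    M.resp (≈-sym (pair-η f)) (exchange K-ℤModule M-ℤModule con fh∈ s″h∈ s″q∈)
    where
    s″h∈ : K (pair (intComb m c (λ i → g i ∘ inj₁) +v s) h)
    s″h∈ = IsℤModule.resp K-ℤModule
      (pair-cong (λ _ → refl) λ b → sym (trans (eq (inj₁ b)) (cong (_+ w (inj₁ b)) (intComb-∘ inj₁ m c gL b))))
      (intComb-pair-∈ K-ℤModule m c (proj₂ ∘ partner)
        (V⊆K _ (flip⊎-pair⁻ V-ℤModule ws∈)))

    s″q∈ : M (pair (intComb m c (λ i → g i ∘ inj₁) +v s) (f ∘ inj₂))
    s″q∈ = M.resp
      (pair-cong (λ _ → refl) λ b → sym (trans (eq (inj₂ b)) (cong (_+ w (inj₂ b)) (intComb-∘ inj₂ m c gL b))))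
      (intComb-pair-∈ M-ℤModule m c g-pair-∈ (W⊆M _ sw∈))

  ⊆L : M ⊆ compose K L
  ⊆L f f∈ with proj₁ (M⇔ f) f∈
  ... | c , w , w∈ , eq with W⊆V (w ∘ inj₁) (w ∘ inj₂ , IsSubspace.resp W-subspace (pair-η w) w∈)
  -- The middle vector combines the chosen partners with the coefficients of `f`, plus a vector `h`
  -- matched in `V` with the `A`-part of `w`.
  ... | h , wh∈ = (intComb m c (proj₁ ∘ partner) +v h) ,
    IsℤModule.resp K-ℤModule
      (pair-cong (λ a → sym (trans (eq (inj₁ a)) (cong (_+ w (inj₁ a)) (intComb-∘ inj₁ m c g a)))) λ _ → refl)
      (intComb-pair-∈ K-ℤModule m c (proj₂ ∘ partner) (V⊆K _ wh∈)) ,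
    (c , pair h (w ∘ inj₂) ,
      (w ∘ inj₁ , flip⊎-pair⁺ V-ℤModule wh∈ , IsSubspace.resp W-subspace (pair-η w) w∈) ,
      λ { (inj₁ b) → cong (_+ h b) (sym (intComb-∘ inj₁ m c gL b))
        ; (inj₂ q) → trans (eq (inj₂ q)) (cong (_+ w (inj₂ q))
            (trans (intComb-∘ inj₂ m c g q) (sym (intComb-∘ inj₂ m c gL q)))) })

theorem3 : (s p q : ℕ) →
    ((KSP : VSet (Fin s ⊎ Fin p)) (KSQ : VSet (Fin s ⊎ Fin q)) → IsGNL KSP → IsGNL KSQ →
    ((Σ (VSet (Fin p ⊎ Fin q)) λ KPQ → IsGNL KPQ × (compose KSP KPQ ≐ KSQ))
    → (restrict KSQ ⊆ restrict KSP) × (contract KSP ⊆ contract KSQ))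
    × ((restrict KSQ ⊆ restrict KSP) × (contract KSP ⊆ contract KSQ)
    → Σ (VSet (Fin p ⊎ Fin q)) λ KPQ → IsGNL KPQ × (compose KSP KPQ ≐ KSQ)))
    ×
    ((KSP : VSet (Fin s ⊎ Fin p)) (KPQ : VSet (Fin p ⊎ Fin q)) (KSQ : VSet (Fin s ⊎ Fin q)) →
    IsGNL KSP → IsGNL KPQ → IsGNL KSQ → compose KSP KPQ ≐ KSQ →
    ((compose (flip⊎ KSP) KSQ ≐ KPQ)
    → (restrict KPQ ⊆ restrict (flip⊎ KSP)) × (contract (flip⊎ KSP) ⊆ contract KPQ))
    × ((restrict KPQ ⊆ restrict (flip⊎ KSP)) × (contract (flip⊎ KSP) ⊆ contract KPQ)
    → compose (flip⊎ KSP) KSQ ≐ KPQ))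
    ×
    ((KSP : VSet (Fin s ⊎ Fin p)) (KSQ : VSet (Fin s ⊎ Fin q)) (K̂PQ KPQ : VSet (Fin p ⊎ Fin q)) →
    IsGNL KSP → IsGNL KSQ →
    IsGNL K̂PQ → compose KSP K̂PQ ≐ KSQ →
    restrict K̂PQ ⊆ restrict (flip⊎ KSP) → contract (flip⊎ KSP) ⊆ contract K̂PQ →
    IsGNL KPQ → compose KSP KPQ ≐ KSQ →
    restrict KPQ ⊆ restrict (flip⊎ KSP) → contract (flip⊎ KSP) ⊆ contract KPQ →
    KPQ ≐ K̂PQ)
theorem3 s p q =
  (λ KSP KSQ KSP-GNL KSQ-GNL →
    (λ { (KPQ , KPQ-GNL , eq) → compose-necessary KSP (GNL⇒ℤModule KPQ-GNL) eq }) ,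
    (λ { (res , con) → compose-sufficient KSP-GNL KSQ-GNL res con })) ,
  (λ KSP KPQ KSQ KSP-GNL KPQ-GNL KSQ-GNL eq →
    -- The necessary conditions of part 1, for the equation with the roles of S and P interchanged.
    compose-necessary (flip⊎ KSP) (GNL⇒ℤModule KSQ-GNL) ,
    (λ { (res , con) → compose-invert (GNL⇒ℤModule KSP-GNL) (GNL⇒ℤModule KPQ-GNL) eq res con })) ,
  (λ KSP KSQ K̂PQ KPQ KSP-GNL KSQ-GNL K̂PQ-GNL êq r̂es ĉon KPQ-GNL eq res con →
    -- Both solutions equal the composition of `flip⊎ KSP` with `KSQ`.
    let K = GNL⇒ℤModule KSP-GNL
        ⊆K̂ , K̂⊆ = compose-invert K (GNL⇒ℤModule K̂PQ-GNL) êq r̂es ĉon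
        ⊆K , K⊆ = compose-invert K (GNL⇒ℤModule KPQ-GNL) eq res con
    in (λ f f∈ → ⊆K̂ f (K⊆ f f∈)) , (λ f f∈ → ⊆K f (K̂⊆ f f∈)))
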